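{- The minimum size $f(d)$ of a double cover of $\{0,1,2\}^d$ satisfies $f(6)\le 81$, and $$f(d)\le\left(\tfrac65+o(1)\right)2^d\qquad (d\to\infty),$$ i.e. $\limsup_{d\to\infty} f(d)/2^d\le \tfrac65$.
   Context: Write $[3]=\{0,1,2\}$. A proper sub-box of $[3]^d$ is a set $B=S_1\times\dots\times S_d$ with $\varnothing\neq S_i\subsetneq[3]$ for every $1\le i\le d$ (so each side $S_i$ has one or two elements). A double cover of $[3]^d$ is a finite multiset $\{B_1,\dots,B_m\}$ of proper sub-boxes such that every point of $[3]^d$ lies in exactly two of the $B_j$, counted with multiplicity; its size is $m$. $f(d)$ denotes the minimum size of a double cover of $[3]^d$. It is known from earlier work that $[3]^3$ has a double cover with $11$ boxes. -}

module Defs where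

open import Data.Bool using (true; false)
open import Data.Empty using (⊥-elim)
open import Data.Fin using (Fin; zero; suc)
import Data.Fin.Properties as Fin
open import Data.Fin.Subset using (Subset; inside; outside; Nonempty; _∈_; _⊂_; ⊤)
open import Data.Fin.Subset.Properties using (_∈?_; _⊂?_; nonempty?; anySubset?)
open import Data.Integer using (+_)
open import Data.List using (List; []; _∷_; _++_; length; filter; map)
open import Data.List.Properties using (length-++; length-map; filter-++)
open import Data.List.Relation.Unary.All as All using (All; []; _∷_)
import Data.List.Relation.Unary.All.Properties as All
open import Data.Nat using (ℕ; zero; suc; _+_; _≤_; _≟_; z≤n)
open import Data.Nat.Properties using (+-identityʳ; +-suc; ≤∧≢⇒<)
open import Data.Product using (∃; ∃-syntax; _×_; _,_; proj₁; proj₂)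
open import Data.Rational as ℚ using (ℚ; 0ℚ)
open import Data.Rational.Literals using (fromℤ)
open import Data.Vec as Vec using (Vec; []; _∷_)
open import Data.Vec.Properties using (toList∘fromList; length-toList)
open import Data.Vec.Relation.Binary.Pointwise.Inductive as Pointwise
  using (Pointwise)
open import Data.Vec.Relation.Unary.All as VecAll using ([]; _∷_)
open import Function using (_∘_)
open import Relation.Binary.PropositionalEquality
  using (_≡_; refl; sym; trans; cong; cong₂; subst)
open import Relation.Nullary using (¬_; Dec; yes; no; does)
open import Relation.Nullary.Decidable using (_×-dec_; ¬?; map′; toWitness; decidable-stable)
open import Relation.Unary using (Decidable)

Point : ℕ → Set
Point d = Vec (Fin 3) d

-- The box S₁ × ⋯ × S_d is given by its sides; when all sides are nonempty
-- they are determined by the product set.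
Box : ℕ → Set
Box d = Vec (Subset 3) d

ProperSide : Subset 3 → Set
ProperSide S = Nonempty S × S ⊂ ⊤

ProperBox : ∀ {d} → Box d → Set
ProperBox = VecAll.All ProperSide

infix 4 _∈ᴮ_ _∈ᴮ?_

_∈ᴮ_ : ∀ {d} → Point d → Box d → Set
x ∈ᴮ B = Pointwise _∈_ x B

_∈ᴮ?_ : ∀ {d} (x : Point d) (B : Box d) → Dec (x ∈ᴮ B)
_∈ᴮ?_ = Pointwise.decidable _∈?_

multiplicity : ∀ {d} → Point d → List (Box d) → ℕ
multiplicity x Bs = length (filter (x ∈ᴮ?_) Bs)

-- Multisets of boxes are represented by lists: neither the condition below
-- nor the length depends on the order.
IsDoubleCover : ∀ {d} → List (Box d) → Set
IsDoubleCover Bs = All ProperBox Bs × (∀ x → multiplicity x Bs ≡ 2)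

HasDoubleCover : ℕ → ℕ → Set
HasDoubleCover d m = ∃[ Bs ] IsDoubleCover {d} Bs × length Bs ≡ m

IsMinimum : (ℕ → Set) → ℕ → Set
IsMinimum P m = P m × (∀ n → P n → m ≤ n)

-- The minimum exists: sizes of double covers are decidable, and splitting
-- every axis as {0} ∪ {1,2} and taking each product box twice gives a double
-- cover.

private
  Searchable : Set → Set₁
  Searchable A = ∀ {P : A → Set} → Decidable P → Dec (∃ P)

  anyVec? : ∀ {A} → Searchable A → ∀ n → Searchable (Vec A n)
  anyVec? any zero    P? = map′ ([] ,_) (λ { ([] , p) → p }) (P? [])
  anyVec? any (suc n) P? =
    map′ (λ { (x , xs , p) → x ∷ xs , p }) (λ { (x ∷ xs , p) → x , xs , p })
         (any (λ x → anyVec? any n (λ xs → P? (x ∷ xs))))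

  all? : ∀ {A} → Searchable A → {P : A → Set} → Decidable P → Dec (∀ x → P x)
  all? any P? =
    map′ (λ ¬∃ x → decidable-stable (P? x) (λ ¬p → ¬∃ (x , ¬p)))
         (λ { ∀p (x , ¬p) → ¬p (∀p x) })
         (¬? (any (¬? ∘ P?)))

  properSide? : Decidable ProperSide
  properSide? S = nonempty? S ×-dec (S ⊂? ⊤)

  isDoubleCover? : ∀ {d} → Decidable (IsDoubleCover {d})
  isDoubleCover? {d} Bs =
    All.all? (VecAll.all? properSide?) Bs
    ×-dec all? (anyVec? Fin.any? d) (λ x → multiplicity x Bs ≟ 2)

  hasDoubleCover? : ∀ d → Decidable (HasDoubleCover d)
  hasDoubleCover? d m =
    map′ (λ { (v , c) → Vec.toList v , c , length-toList v })
         (λ { (Bs , c , refl) →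
              Vec.fromList Bs , subst IsDoubleCover (sym (toList∘fromList Bs)) c })
         (anyVec? (anyVec? anySubset? d) m (λ v → isDoubleCover? (Vec.toList v)))

  leastFrom : ∀ {P : ℕ → Set} → Decidable P → ∀ k n → (∀ i → P i → n ≤ i) →
              P (k + n) → ∃ (IsMinimum P)
  leastFrom P? zero    n lb p = n , p , lb
  leastFrom {P} P? (suc k) n lb p with P? n
  ... | yes q = n , q , lb
  ... | no ¬q = leastFrom P? k (suc n)
                  (λ i q → ≤∧≢⇒< (lb i q) λ { refl → ¬q q })
                  (subst P (sym (+-suc k n)) p)

  least : ∀ {P : ℕ → Set} → Decidable P → ∃ P → ∃ (IsMinimum P)
  least {P} P? (n , p) =
    leastFrom P? n 0 (λ _ _ → z≤n) (subst P (sym (+-identityʳ n)) p)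

  S₀ S₁₂ : Subset 3
  S₀  = inside  ∷ outside ∷ outside ∷ []
  S₁₂ = outside ∷ inside  ∷ inside  ∷ []

  module _ {d} (a : Fin 3) (x : Point d) (S : Subset 3) where

    mult-in : a ∈ S → ∀ Bs → multiplicity (a ∷ x) (map (S ∷_) Bs) ≡ multiplicity x Bs
    mult-in a∈S [] = refl
    mult-in a∈S (B ∷ Bs) with a ∈? S
    ... | no a∉S = ⊥-elim (a∉S a∈S)
    ... | yes _ with does (x ∈ᴮ? B)
    ...   | true  = cong suc (mult-in a∈S Bs)
    ...   | false = mult-in a∈S Bs

    mult-out : ¬ a ∈ S → ∀ Bs → multiplicity (a ∷ x) (map (S ∷_) Bs) ≡ 0
    mult-out a∉S [] = refl
    mult-out a∉S (B ∷ Bs) with a ∈? S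
    ... | yes a∈S = ⊥-elim (a∉S a∈S)
    ... | no _    = mult-out a∉S Bs

  mult-++ : ∀ {d} (x : Point d) Bs Cs →
            multiplicity x (Bs ++ Cs) ≡ multiplicity x Bs + multiplicity x Cs
  mult-++ x Bs Cs =
    trans (cong length (filter-++ (x ∈ᴮ?_) Bs Cs)) (length-++ (filter (x ∈ᴮ?_) Bs))

  someCover : ∀ d → ∃ (IsDoubleCover {d})
  someCover zero = [] ∷ [] ∷ [] , [] ∷ [] ∷ [] , λ { [] → refl }
  someCover (suc d) with someCover d
  ... | Bs , proper , twice = Cs , proper′ , twice′
    where
    Cs : List (Box (suc d))
    Cs = map (S₀ ∷_) Bs ++ map (S₁₂ ∷_) Bs
    proper′ : All ProperBox Cs
    proper′ = All.++⁺
      (All.map⁺ (All.map (toWitness {a? = properSide? S₀} _ ∷_) proper))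
      (All.map⁺ (All.map (toWitness {a? = properSide? S₁₂} _ ∷_) proper))
    split : ∀ a x {m n} → multiplicity (a ∷ x) (map (S₀ ∷_) Bs) ≡ m →
            multiplicity (a ∷ x) (map (S₁₂ ∷_) Bs) ≡ n →
            multiplicity (a ∷ x) Cs ≡ m + n
    split a x p q = trans (mult-++ (a ∷ x) (map (S₀ ∷_) Bs) _) (cong₂ _+_ p q)
    twice′ : ∀ x → multiplicity x Cs ≡ 2
    twice′ (zero ∷ x) = split zero x
      (trans (mult-in zero x S₀ (toWitness {a? = zero ∈? S₀} _) Bs) (twice x))
      (mult-out zero x S₁₂ (λ ()) Bs)
    twice′ (suc b ∷ x) = split (suc b) x
      (mult-out (suc b) x S₀ (∉S₀ b) Bs)
      (trans (mult-in (suc b) x S₁₂ (∈S₁₂ b) Bs) (twice x))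
      where
      ∉S₀ : ∀ b → ¬ suc b ∈ S₀
      ∉S₀ zero       (Vec.there ())
      ∉S₀ (suc zero) (Vec.there (Vec.there ()))
      ∈S₁₂ : ∀ b → suc b ∈ S₁₂
      ∈S₁₂ zero       = Vec.there Vec.here
      ∈S₁₂ (suc zero) = Vec.there (Vec.there Vec.here)

-- Abstract so that the exhaustive search never unfolds; f-isMinimum
-- determines f.
abstract
  minimumSize : ∀ d → ∃ (IsMinimum (HasDoubleCover d))
  minimumSize d with someCover d
  ... | Bs , c = least (hasDoubleCover? d) (length Bs , Bs , c , refl)

f : ℕ → ℕ
f d = proj₁ (minimumSize d)

f-isMinimum : ∀ d → IsMinimum (HasDoubleCover d) (f d)
f-isMinimum d = proj₂ (minimumSize d)

fromℕ : ℕ → ℚ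
fromℕ n = fromℤ (+ n)

-- δ(n) = o(1) as n → ∞.
IsLittleO1 : (ℕ → ℚ) → Set
IsLittleO1 δ = ∀ (ε : ℚ) → 0ℚ ℚ.< ε → ∃[ N ] ∀ n → N ≤ n → ℚ.∣ δ n ∣ ℚ.< ε

{-# OPTIONS --safe #-}

-- Suppose boxes A₁,…,A_a and C₁,…,C_c of [3]³ are such that every point lies
-- in exactly two of them when the A's are counted twice. Then the products of
-- the A's with a double cover of [3]^d, together with the products of the C's
-- with a partition of [3]^d into 2^d boxes, form a double cover of [3]^(3+d),
-- so that f(3+d) ≤ a f(d) + c 2^d. A computer search found such a family with
-- a = 3 and c = 6, whence the constant c / (2³ - a) = 6/5, and a double cover
-- of [3]³ with 11 boxes, whence f(6) ≤ 3·11 + 6·8 = 81.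

module Submission where

open import Defs
open import Data.Bool using (true; false)
import Data.Fin.Properties as Fin
open import Data.Fin.Subset using (Subset; inside; outside)
open import Data.Fin.Subset.Properties using (nonempty?; _⊂?_)
open import Data.Integer as ℤ using (+_)
import Data.Integer.Properties as ℤ
open import Data.List as List using (List; []; _∷_; length; filter; map; cartesianProductWith)
open import Data.List.Properties
  using (length-++; length-map; filter-++; filter-≐; filter-none)
open import Data.List.Relation.Unary.All as All using (All; []; _∷_)
import Data.List.Relation.Unary.All.Properties as All
open import Data.Nat using (ℕ; zero; suc; _+_; _*_; _≤_; _^_; _≟_)
open import Data.Nat.Properties
open import Data.Nat.Tactic.RingSolver using (solve-∀)
open import Data.Product using (_×_; ∃-syntax; _,_; proj₁; proj₂)
open import Data.Rational as ℚ using (ℚ; mkℚ; 0ℚ)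
import Data.Rational.Properties as ℚ
open import Data.Rational.Unnormalised as ℚᵘ using (mkℚᵘ)
import Data.Rational.Unnormalised.Properties as ℚᵘ
open import Data.Vec as Vec using (Vec; []; _∷_; _++_)
import Data.Vec.Relation.Binary.Pointwise.Inductive as Pointwise
import Data.Vec.Relation.Unary.All as VecAll
import Data.Vec.Relation.Unary.All.Properties as VecAll
open import Function using (_∘_)
open import Relation.Binary.PropositionalEquality
open import Relation.Nullary using (¬_; yes; no; does)
open import Relation.Nullary.Decidable using (True; toWitness; _×-dec_)
open import Relation.Unary using (Decidable)

-- Products of families of boxes

length-filter-map : ∀ {A B : Set} {P : B → Set} (P? : Decidable P) (g : A → B) xs →
                    length (filter P? (map g xs)) ≡ length (filter (P? ∘ g) xs)
length-filter-map P? g [] = refl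
length-filter-map P? g (x ∷ xs) with does (P? (g x))
... | true  = cong suc (length-filter-map P? g xs)
... | false = length-filter-map P? g xs

length-cartesianProductWith : ∀ {A B C : Set} (g : A → B → C) xs ys →
                              length (cartesianProductWith g xs ys) ≡ length xs * length ys
length-cartesianProductWith g []       ys = refl
length-cartesianProductWith g (x ∷ xs) ys =
  trans (length-++ (map (g x) ys))
        (cong₂ _+_ (length-map (g x) ys) (length-cartesianProductWith g xs ys))

infixr 7 _⊗_

_⊗_ : ∀ {c d} → List (Box c) → List (Box d) → List (Box (c + d))
_⊗_ = cartesianProductWith _++_

multiplicity-++ : ∀ {d} (x : Point d) Bs Cs →
                  multiplicity x (Bs List.++ Cs) ≡ multiplicity x Bs + multiplicity x Cs
multiplicity-++ x Bs Cs =
  trans (cong length (filter-++ (x ∈ᴮ?_) Bs Cs)) (length-++ (filter (x ∈ᴮ?_) Bs))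

module _ {c d} {x : Point c} {B : Box c} (y : Point d) where

  multiplicity-map-∈ : x ∈ᴮ B → ∀ Cs →
                       multiplicity (x ++ y) (map (B ++_) Cs) ≡ multiplicity y Cs
  multiplicity-map-∈ x∈B Cs = begin
    multiplicity (x ++ y) (map (B ++_) Cs)
      ≡⟨ length-filter-map ((x ++ y) ∈ᴮ?_) (B ++_) Cs ⟩
    length (filter (λ C → (x ++ y) ∈ᴮ? (B ++ C)) Cs)
      ≡⟨ cong length (filter-≐ _ (y ∈ᴮ?_)
           (Pointwise.++ʳ⁻ x B , Pointwise.++⁺ x∈B) Cs) ⟩
    multiplicity y Cs ∎
    where open ≡-Reasoning

  multiplicity-map-∉ : ¬ x ∈ᴮ B → ∀ Cs → multiplicity (x ++ y) (map (B ++_) Cs) ≡ 0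
  multiplicity-map-∉ x∉B Cs = cong length (filter-none ((x ++ y) ∈ᴮ?_)
    (All.map⁺ (All.universal (λ C → x∉B ∘ Pointwise.++ˡ⁻ x B) Cs)))

-- Membership in a product box is coordinatewise. So each box of `Bs` through `x` contributes
-- `multiplicity y Cs` product boxes through `x ++ y`, and every other box contributes none.
multiplicity-⊗ : ∀ {c d} (x : Point c) (y : Point d) Bs Cs →
                 multiplicity (x ++ y) (Bs ⊗ Cs) ≡ multiplicity x Bs * multiplicity y Cs
multiplicity-⊗ x y [] Cs = refl
multiplicity-⊗ x y (B ∷ Bs) Cs
  rewrite multiplicity-++ (x ++ y) (map (B ++_) Cs) (Bs ⊗ Cs) | multiplicity-⊗ x y Bs Cs
  with x ∈ᴮ? B
... | yes x∈B = cong (_+ multiplicity x Bs * multiplicity y Cs) (multiplicity-map-∈ y x∈B Cs)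
... | no  x∉B = cong (_+ multiplicity x Bs * multiplicity y Cs) (multiplicity-map-∉ y x∉B Cs)

properBox-⊗ : ∀ {c d} {Bs : List (Box c)} {Cs : List (Box d)} →
              All ProperBox Bs → All ProperBox Cs → All ProperBox (Bs ⊗ Cs)
properBox-⊗ {Bs = Bs} {Cs} ps qs =
  All.cartesianProductWith⁺ (setoid _) (setoid _) _++_ Bs Cs
    (λ B∈ C∈ → VecAll.++⁺ (All.lookup ps B∈) (All.lookup qs C∈))

-- Partitions into proper boxes

record IsPartition {d} (Bs : List (Box d)) : Set where
  field
    proper : All ProperBox Bs
    once   : ∀ x → multiplicity x Bs ≡ 1

properBoxes? : ∀ {d} → Decidable (All (ProperBox {d}))
properBoxes? = All.all? (VecAll.all? (λ S → nonempty? S ×-dec (S ⊂? _)))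

S₀ S₁ S₂ S₀₁ S₀₂ S₁₂ : Subset 3
S₀  = inside  ∷ outside ∷ outside ∷ []
S₁  = outside ∷ inside  ∷ outside ∷ []
S₂  = outside ∷ outside ∷ inside  ∷ []
S₀₁ = inside  ∷ inside  ∷ outside ∷ []
S₀₂ = inside  ∷ outside ∷ inside  ∷ []
S₁₂ = outside ∷ inside  ∷ inside  ∷ []

linePartition : List (Box 1)
linePartition = (S₀ ∷ []) ∷ (S₁₂ ∷ []) ∷ []

partition : ∀ d → List (Box d)
partition zero    = [] ∷ []
partition (suc d) = linePartition ⊗ partition d

length-partition : ∀ d → length (partition d) ≡ 2 ^ d
length-partition zero    = refl
length-partition (suc d) =
  trans (length-cartesianProductWith _++_ linePartition (partition d))
        (cong (2 *_) (length-partition d))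

isPartition : ∀ d → IsPartition (partition d)
isPartition zero = record { proper = VecAll.[] ∷ [] ; once = λ { [] → refl } }
isPartition (suc d) = record
  { proper = properBox-⊗ (toWitness {a? = properBoxes? linePartition} _) proper
  -- `a ∷ x` is `(a ∷ []) ++ x` by computation, so the product formula applies and gives 1 · 1.
  ; once   = λ { (a ∷ x) → trans (multiplicity-⊗ (a ∷ []) x linePartition (partition d))
                                 (cong₂ _*_ (line a) (once x)) }
  }
  where
  open IsPartition (isPartition d)
  line : ∀ a → multiplicity (a ∷ []) linePartition ≡ 1
  line = toWitness {a? = Fin.all? (λ a → multiplicity (a ∷ []) linePartition ≟ 1)} _

-- Double covers from weighted covers

IsWeightedCover : ∀ {d} → List (Box d) → List (Box d) → Set
IsWeightedCover Bs Cs = ∀ x → multiplicity x Bs * 2 + multiplicity x Cs * 1 ≡ 2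

-- The weights 2 and 1 are the constant multiplicities of `Ds` and `Ps`, so the multiplicity at
-- `x ++ y` depends on `x` alone and is the weighted count there.
isDoubleCover-⊗ : ∀ {c d} {Bs Cs : List (Box c)} {Ds Ps : List (Box d)} →
                  All ProperBox Bs → All ProperBox Cs → IsWeightedCover Bs Cs →
                  IsDoubleCover Ds → IsPartition Ps → IsDoubleCover (Bs ⊗ Ds List.++ Cs ⊗ Ps)
isDoubleCover-⊗ {c} {Bs = Bs} {Cs} {Ds} {Ps} properB properC weighted (properD , twice) P =
  All.++⁺ (properBox-⊗ properB properD) (properBox-⊗ properC proper) , twice′
  where
  open IsPartition P
  open ≡-Reasoning
  twice′ : ∀ z → multiplicity z (Bs ⊗ Ds List.++ Cs ⊗ Ps) ≡ 2
  twice′ z with Vec.splitAt c z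
  ... | x , y , refl = begin
    multiplicity (x ++ y) (Bs ⊗ Ds List.++ Cs ⊗ Ps)
      ≡⟨ multiplicity-++ (x ++ y) (Bs ⊗ Ds) (Cs ⊗ Ps) ⟩
    multiplicity (x ++ y) (Bs ⊗ Ds) + multiplicity (x ++ y) (Cs ⊗ Ps)
      ≡⟨ cong₂ _+_ (multiplicity-⊗ x y Bs Ds) (multiplicity-⊗ x y Cs Ps) ⟩
    multiplicity x Bs * multiplicity y Ds + multiplicity x Cs * multiplicity y Ps
      ≡⟨ cong₂ (λ m n → multiplicity x Bs * m + multiplicity x Cs * n) (twice y) (once y) ⟩
    multiplicity x Bs * 2 + multiplicity x Cs * 1
      ≡⟨ weighted x ⟩
    2 ∎

-- Explicit families in dimension 3, checked on all 27 points

byExhaustion : {P : Point 3 → Set} → (P? : Decidable P) →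
               True (Fin.all? λ a → Fin.all? λ b → Fin.all? λ c → P? (a ∷ b ∷ c ∷ [])) → ∀ x → P x
byExhaustion P? t (a ∷ b ∷ c ∷ []) = toWitness t a b c

-- `As` consists of three single points, any two of which differ in every coordinate. The six 2 × 2
-- × 2 boxes `Cs` avoid these points and cover each of the other 24 twice, in accordance with 6 · 8
-- = 2 · 24.
As Cs : List (Box 3)
As = (S₀ ∷ S₂ ∷ S₁ ∷ []) ∷ (S₁ ∷ S₁ ∷ S₂ ∷ []) ∷ (S₂ ∷ S₀ ∷ S₀ ∷ []) ∷ []
Cs = (S₀₁ ∷ S₀₁ ∷ S₀₁ ∷ []) ∷ (S₀₁ ∷ S₀₂ ∷ S₀₂ ∷ []) ∷ (S₀₂ ∷ S₀₁ ∷ S₁₂ ∷ [])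
   ∷ (S₀₂ ∷ S₁₂ ∷ S₀₂ ∷ []) ∷ (S₁₂ ∷ S₀₂ ∷ S₁₂ ∷ []) ∷ (S₁₂ ∷ S₁₂ ∷ S₀₁ ∷ []) ∷ []

isWeightedCover : IsWeightedCover As Cs
isWeightedCover = byExhaustion (λ x → multiplicity x As * 2 + multiplicity x Cs * 1 ≟ 2) _

-- This is again a weighted product, with the second axis as the second factor. In the first and
-- third coordinates, four boxes cover every point but (2, 0) twice; they are multiplied by the
-- partition `S₀₁`, `S₂`. The point (2, 0) is multiplied by the double cover `S₀₁`, `S₀₂`, `S₁₂` of
-- the line. The size is 4 · 2 + 3.
elevenBoxes : List (Box 3)
elevenBoxes =
    (S₀₁ ∷ S₀₁ ∷ S₀₁ ∷ []) ∷ (S₀₁ ∷ S₀₁ ∷ S₀₂ ∷ []) ∷ (S₀₁ ∷ S₂ ∷ S₀₁ ∷ [])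
  ∷ (S₀₁ ∷ S₂ ∷ S₀₂ ∷ []) ∷ (S₂ ∷ S₀₁ ∷ S₀ ∷ []) ∷ (S₂ ∷ S₀₂ ∷ S₀ ∷ [])
  ∷ (S₂ ∷ S₁₂ ∷ S₀ ∷ []) ∷ (S₀₂ ∷ S₀₁ ∷ S₁₂ ∷ []) ∷ (S₀₂ ∷ S₂ ∷ S₁₂ ∷ [])
  ∷ (S₁₂ ∷ S₀₁ ∷ S₁₂ ∷ []) ∷ (S₁₂ ∷ S₂ ∷ S₁₂ ∷ []) ∷ []

isDoubleCover-elevenBoxes : IsDoubleCover elevenBoxes
isDoubleCover-elevenBoxes =
  toWitness {a? = properBoxes? elevenBoxes} _ , byExhaustion (λ x → multiplicity x elevenBoxes ≟ 2) _

-- Recursion and explicit bound for the minimum size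

f-lowerBound : ∀ {d} {Bs : List (Box d)} → IsDoubleCover Bs → f d ≤ length Bs
f-lowerBound {d} {Bs} cover = proj₂ (f-isMinimum d) (length Bs) (Bs , cover , refl)

f[3+d]≤3f[d]+6·2^d : ∀ d → f (3 + d) ≤ 3 * f d + 6 * 2 ^ d
f[3+d]≤3f[d]+6·2^d d with proj₁ (f-isMinimum d)
... | Ds , cover , length≡ = ≤-trans
  (f-lowerBound (isDoubleCover-⊗ (toWitness {a? = properBoxes? As} _)
    (toWitness {a? = properBoxes? Cs} _) isWeightedCover cover (isPartition d)))
  (≤-reflexive (begin
    length (As ⊗ Ds List.++ Cs ⊗ partition d)
      ≡⟨ length-++ (As ⊗ Ds) ⟩
    length (As ⊗ Ds) + length (Cs ⊗ partition d)
      ≡⟨ cong₂ _+_ (length-cartesianProductWith _++_ As Ds)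
                   (length-cartesianProductWith _++_ Cs (partition d)) ⟩
    3 * length Ds + 6 * length (partition d)
      ≡⟨ cong₂ (λ m n → 3 * m + 6 * n) length≡ (length-partition d) ⟩
    3 * f d + 6 * 2 ^ d ∎))
  where open ≡-Reasoning

-- The partition taken twice is a double cover. This starts the induction in `scaledBound` at d = 0,
-- 1, 2.
f≤2^d+2^d : ∀ d → f d ≤ 2 ^ d + 2 ^ d
f≤2^d+2^d d = ≤-trans (f-lowerBound (All.++⁺ proper proper , twice))
  (≤-reflexive (trans (length-++ (partition d))
                      (cong₂ _+_ (length-partition d) (length-partition d))))
  where
  open IsPartition (isPartition d)
  twice : ∀ x → multiplicity x (partition d List.++ partition d) ≡ 2
  twice x = trans (multiplicity-++ x (partition d) (partition d)) (cong₂ _+_ (once x) (once x))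

-- f(d) ≤ (6/5 + 4/(3+d)) 2^d with the denominators cleared. The error term
-- satisfies 3 · 4/(3+d) ≤ 8 · 4/(6+d), so the recursion preserves the bound.
scaledBound : ∀ d → 5 * (3 + d) * f d ≤ (6 * (3 + d) + 20) * 2 ^ d
scaledBound 0 = ≤-trans (*-monoʳ-≤ 15 (f≤2^d+2^d 0)) (m≤m+n 30 8)
scaledBound 1 = ≤-trans (*-monoʳ-≤ 20 (f≤2^d+2^d 1)) (m≤m+n 80 8)
-- Equality holds here, as 6/5 + 4/5 = 2: the numerator 4 of the error term is the least that the
-- trivial bound allows at d = 2.
scaledBound 2 = ≤-trans (*-monoʳ-≤ 25 (f≤2^d+2^d 2)) (≤-refl {200})
-- The factor `3 + d` clears the denominator in the induction hypothesis, next to `6 + d` from the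
-- goal.
scaledBound (suc (suc (suc d))) = *-cancelˡ-≤ (3 + d) (begin
  (3 + d) * (5 * (6 + d) * f (3 + d))
    ≤⟨ *-monoʳ-≤ (3 + d) (*-monoʳ-≤ (5 * (6 + d)) (f[3+d]≤3f[d]+6·2^d d)) ⟩
  (3 + d) * (5 * (6 + d) * (3 * f d + 6 * 2 ^ d))
    ≡⟨ regroup d (f d) (2 ^ d) ⟩
  3 * (6 + d) * (5 * (3 + d) * f d) + 30 * (6 + d) * (3 + d) * 2 ^ d
    ≤⟨ +-monoˡ-≤ _ (*-monoʳ-≤ (3 * (6 + d)) (scaledBound d)) ⟩
  3 * (6 + d) * ((6 * (3 + d) + 20) * 2 ^ d) + 30 * (6 + d) * (3 + d) * 2 ^ d
    -- The main terms agree, as 3 · 6 + 30 = 8 · 6. The slack is the difference of the error terms,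
    -- 8 · 20 (3 + d) - 3 · 20 (6 + d).
    ≤⟨ m≤m+n _ ((100 * d + 120) * 2 ^ d) ⟩
  3 * (6 + d) * ((6 * (3 + d) + 20) * 2 ^ d) + 30 * (6 + d) * (3 + d) * 2 ^ d
    + (100 * d + 120) * 2 ^ d
    ≡⟨ collect d (2 ^ d) ⟩
  (3 + d) * ((6 * (6 + d) + 20) * 2 ^ (3 + d)) ∎)
  where
  open ≤-Reasoning
  regroup : ∀ d g p → (3 + d) * (5 * (6 + d) * (3 * g + 6 * p)) ≡
            3 * (6 + d) * (5 * (3 + d) * g) + 30 * (6 + d) * (3 + d) * p
  regroup = solve-∀
  collect : ∀ d p → 3 * (6 + d) * ((6 * (3 + d) + 20) * p) + 30 * (6 + d) * (3 + d) * p
              + (100 * d + 120) * p ≡ (3 + d) * ((6 * (6 + d) + 20) * (2 * (2 * (2 * p))))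
  collect = solve-∀

-- The error term and the passage to rationals

δ : ℕ → ℚ
δ d = + 4 ℚ./ (3 + d)

δ-isLittleO1 : IsLittleO1 δ
δ-isLittleO1 (mkℚ (+ 0) _ _) (ℚ.*<* (ℤ.+<+ ()))
-- The denominator of ε is `suc e-1` and its numerator is at least 1, so 4/(3 + d) < ε once d is at
-- least four times the denominator.
δ-isLittleO1 ε@(mkℚ (+ suc k) e-1 _) _ = 4 * suc e-1 , λ d N≤d →
  subst (ℚ._< ε) (sym (ℚ.0≤p⇒∣p∣≡p (ℚ.nonNegative⁻¹ (δ d) {{ℚ.normalize-nonNeg 4 (3 + d)}})))
    (ℚ.toℚᵘ-cancel-< (ℚᵘ.<-respˡ-≃ (ℚᵘ.≃-sym (ℚ.toℚᵘ-fromℚᵘ (mkℚᵘ (+ 4) (2 + d))))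
      (ℚᵘ.*<* (ℤ.+<+ (begin-strict
        4 * suc e-1       ≤⟨ N≤d ⟩
        d                 <⟨ m≤n+m (suc d) 2 ⟩
        3 + d             ≤⟨ m≤n*m (3 + d) (suc k) ⟩
        suc k * (3 + d)   ∎)))))
  where open ≤-Reasoning

-- In unnormalised rationals the sum 6/5 + 4/(3 + d) computes to (6 (3 + d) + 4 · 5) / (5 (3 + d))
-- without reduction, so cross-multiplication yields exactly the hypothesis, up to rearranging
-- factors.
fromℕ-≤ : ∀ d g p → 5 * (3 + d) * g ≤ (6 * (3 + d) + 20) * p →
          fromℕ g ℚ.≤ (+ 6 ℚ./ 5 ℚ.+ δ d) ℚ.* fromℕ p
fromℕ-≤ d g p h = ℚ.toℚᵘ-cancel-≤ (ℚᵘ.≤-respʳ-≃ (ℚᵘ.≃-sym rhs≃)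
  (ℚᵘ.*≤* (subst₂ ℤ._≤_ lhs≡ rhs≡ (ℤ.+≤+ h))))
  where
  rhs≃ : ℚ.toℚᵘ ((+ 6 ℚ./ 5 ℚ.+ δ d) ℚ.* fromℕ p) ℚᵘ.≃
         (mkℚᵘ (+ 6) 4 ℚᵘ.+ mkℚᵘ (+ 4) (2 + d)) ℚᵘ.* mkℚᵘ (+ p) 0
  rhs≃ = ℚᵘ.≃-trans (ℚ.toℚᵘ-homo-* (+ 6 ℚ./ 5 ℚ.+ δ d) (fromℕ p))
    (ℚᵘ.*-congʳ (ℚᵘ.≃-trans (ℚ.toℚᵘ-homo-+ (+ 6 ℚ./ 5) (δ d))
      (ℚᵘ.+-congʳ (mkℚᵘ (+ 6) 4) (ℚ.toℚᵘ-fromℚᵘ (mkℚᵘ (+ 4) (2 + d))))))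
  lhs≡ : + (5 * (3 + d) * g) ≡ + g ℤ.* + (5 * (3 + d) * 1)
  lhs≡ = trans (cong +_ (eq d g)) (ℤ.pos-* g _)
    where
    eq : ∀ d g → 5 * (3 + d) * g ≡ g * (5 * (3 + d) * 1)
    eq = solve-∀
  rhs≡ : + ((6 * (3 + d) + 20) * p) ≡ (+ (6 * (3 + d) + 20) ℤ.* + p) ℤ.* + 1
  rhs≡ = trans (ℤ.pos-* (6 * (3 + d) + 20) p) (sym (ℤ.*-identityʳ _))

corollary7p2 : f 6 ≤ 81 ×
    (∃[ δ ] IsLittleO1 δ × (∀ d → fromℕ (f d) ℚ.≤ (+ 6 ℚ./ 5 ℚ.+ δ d) ℚ.* fromℕ (2 ^ d)))
corollary7p2 =
  ≤-trans (f[3+d]≤3f[d]+6·2^d 3)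
    (+-monoˡ-≤ 48 (*-monoʳ-≤ 3 (f-lowerBound isDoubleCover-elevenBoxes))) ,
  δ , δ-isLittleO1 , λ d → fromℕ-≤ d (f d) (2 ^ d) (scaledBound d)
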